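{- Let $r\equiv5\pmod6$ with $r\ge11$. Let $T$ be a directed rotational terrace of $\mathbb Z_r$ containing the path $9\to6\to7\to5\to8\to3\to10$, let $j\in\mathbb Z_3$, and suppose the output $H$ of the fixed-port construction from $T$ at residue $j$ is a $3$-layer balanced Hamilton starter of $\mathcal C_3(r)$. Then $H$ is chain-compatible, and $0\to2\to4\to\cdots\to2r$ is a compatible deletion chain for $H$.
   Context: Let $[r]=\{1,\ldots,r\}$. $\mathcal C_3(r)$ is the directed Cayley digraph on $\mathbb Z_{3r}$ with arcs $x\to x+s$, $x\in\mathbb Z_{3r}$, $s\in[r]$; the arc $x\to x+s$ has tail $x$ and step $s$. A $3$-layer balanced Hamilton starter is a directed Hamilton cycle of $\mathcal C_3(r)$ containing, for every $(j,s)\in\mathbb Z_3\times[r]$, exactly one arc of step $s$ with tail congruent to $j$ mod $3$. For such $H$ put $H_k=H+3k$ ($k\in\mathbb Z_r$), the image of $H$ under $x\mapsto x+3k$; these partition the arc set. A compatible deletion chain for $H$ is a simple directed path of length $r$ (with $r+1$ distinct vertices) containing exactly one arc from each $H_k$; $H$ is chain-compatible if such a path exists. A directed rotational terrace of $\mathbb Z_r$ is a cyclic ordering $T=(t_0,\ldots,t_{r-2})$ of $\mathbb Z_r\setminus\{0\}$ such that the cyclic differences $d_i=[t_{i+1}-t_i]_r$ ($i\in\mathbb Z_{r-1}$) run through $1,\ldots,r-1$ exactly once, where $[x]_r\in\{1,\ldots,r-1\}$ is the representative of a nonzero $x\in\mathbb Z_r$. $T$ contains a directed path if the vertex sequence of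 the path occurs consecutively, in the displayed order, in the cyclic ordering $T$. Lift: $F_3(T)$ is the spanning subdigraph of $\mathcal C_3(r)$ in which each vertex has exactly one outgoing arc: for $0\le \ell<3$, the vertex $t_i+\ell r$ (with $t_i$ represented in $\{1,\ldots,r-1\}$) has outgoing arc of step $d_i$, and the vertex $\ell r$ has outgoing arc of step $r$. Fixed-port construction at residue $j$: for $x\in\mathbb Z_r$ let $\widetilde x_j\in\mathbb Z_{3r}$ be the unique element congruent to $x$ mod $r$ and to $j$ mod $3$. In $F_3(T)$ the outgoing steps at the tails $\widetilde 9_j,\widetilde 6_j,\widetilde 3_j,\widetilde 0_j$ are $r-3,1,7,r$ respectively; replace them by $1,r,r-3,7$ respectively, leaving all other outgoing arcs unchanged. The resulting spanning subdigraph is the output. -}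

module Defs where

open import Data.Fin using (Fin; toℕ; inject₁; suc)
open import Data.Fin.Properties using (nonZeroIndex)
open import Data.List using (List; length; lookup)
open import Data.Nat using (ℕ; NonZero; _+_; _*_; _∸_; _≤_)
open import Data.Nat.DivMod using (_mod_)
open import Data.Nat.Properties using (m*n≢0)
open import Data.Product using (∃; ∃₂; ∃!; _×_)
open import Function using (_⇔_; Bijective; Injective)
open import Level using (0ℓ)
open import Relation.Binary using (Rel; _⇒_)
open import Relation.Binary.PropositionalEquality using (_≡_; _≢_)
open import Relation.Nullary using (¬_)

------------------------------------------------------------------------
-- ℤₙ is represented by Fin n; natural numbers act on it by translation.

infixl 6 _⊕_ _⊖_

_⊕_ : ∀ {n} → Fin n → ℕ → Fin n
_⊕_ {n} x m = _mod_ (toℕ x + m) n {{nonZeroIndex x}}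

_⊖_ : ∀ {n} → Fin n → Fin n → Fin n
_⊖_ {n} x y = x ⊕ (n ∸ toℕ y)

------------------------------------------------------------------------
-- A spanning (sub)digraph on ℤₙ is identified with its arc relation.

Digraph : ℕ → Set₁
Digraph n = Rel (Fin n) 0ℓ

_∈[_] : ℕ → ℕ → Set
s ∈[ r ] = 1 ≤ s × s ≤ r

C₃ : ∀ r → Digraph (3 * r)
C₃ r x y = ∃ λ s → s ∈[ r ] × y ≡ x ⊕ s

IsHamiltonCycle : ∀ {n} → Digraph n → Digraph n → Set
IsHamiltonCycle {n} G H =
  H ⇒ G ×
  ∃ λ (v : Fin n → Fin n) →
    Bijective _≡_ _≡_ v ×
    (∀ x y → H x y ⇔ (∃ λ i → v i ≡ x × v (i ⊕ 1) ≡ y))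

-- Steps s ∈ [r] are distinct modulo 3r, so an arc of step s with tail x
-- is precisely an arc from x to x ⊕ s.
IsBalanced : ∀ r → Digraph (3 * r) → Set
IsBalanced r H = ∀ (j : Fin 3) s → s ∈[ r ] →
  ∃! _≡_ λ x → toℕ x mod 3 ≡ j × H x (x ⊕ s)

IsBalancedStarter : ∀ r → Digraph (3 * r) → Set
IsBalancedStarter r H = IsHamiltonCycle (C₃ r) H × IsBalanced r H

translate : ∀ {n} → Digraph n → ℕ → Digraph n
translate H m x y = ∃₂ λ x′ y′ → H x′ y′ × x′ ⊕ m ≡ x × y′ ⊕ m ≡ y

layer : ∀ r → Digraph (3 * r) → Fin r → Digraph (3 * r)
layer r H k = translate H (3 * toℕ k)

-- The vertices of the path are p 0, …, p r, and its arcs are indexed by Fin r.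
IsDeletionChain : ∀ r → Digraph (3 * r) → (Fin (1 + r) → Fin (3 * r)) → Set
IsDeletionChain r H p =
  Injective _≡_ _≡_ p ×
  (∀ (i : Fin r) → C₃ r (p (inject₁ i)) (p (suc i))) ×
  (∀ (k : Fin r) → ∃! _≡_ λ (i : Fin r) → layer r H k (p (inject₁ i)) (p (suc i)))

IsChainCompatible : ∀ r → Digraph (3 * r) → Set
IsChainCompatible r H = ∃ λ p → IsDeletionChain r H p

------------------------------------------------------------------------
-- A cyclic ordering of length r - 1 is a function on Fin (r ∸ 1), whose
-- indices are read modulo r - 1.

-- The representative [ x ]ᵣ ∈ {1, …, r-1} of a nonzero x : Fin r is toℕ x, so
-- running through ℤᵣ ∖ {0} is the same as running through 1, …, r-1.
EnumeratesNonzero : ∀ {r} → (Fin (r ∸ 1) → Fin r) → Set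
EnumeratesNonzero {r} f =
  (∀ i → toℕ (f i) ≢ 0) ×
  (∀ (y : Fin r) → toℕ y ≢ 0 → ∃! _≡_ λ i → f i ≡ y)

difference : ∀ {r} → (Fin (r ∸ 1) → Fin r) → Fin (r ∸ 1) → Fin r
difference t i = t (i ⊕ 1) ⊖ t i

IsTerrace : ∀ {r} → (Fin (r ∸ 1) → Fin r) → Set
IsTerrace t = EnumeratesNonzero t × EnumeratesNonzero (difference t)

-- The entries of the list are compared as natural numbers, so they must be
-- the representatives in {0, …, r-1}.
ContainsPath : ∀ {r} → (Fin (r ∸ 1) → Fin r) → List ℕ → Set
ContainsPath t p = ∃ λ i → ∀ (m : Fin (length p)) → toℕ (t (i ⊕ toℕ m)) ≡ lookup p m

------------------------------------------------------------------------

-- The digraph whose arcs out of x are those with the steps allowed by S x.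
withSteps : ∀ {n} → (Fin n → ℕ → Set) → Digraph n
withSteps S x y = ∃ λ s → S x s × y ≡ x ⊕ s

data LiftStep (r : ℕ) (t : Fin (r ∸ 1) → Fin r) (x : Fin (3 * r)) : ℕ → Set where
  nonzero : ∀ (ℓ : Fin 3) i → toℕ x ≡ toℕ (t i) + toℕ ℓ * r →
            LiftStep r t x (toℕ (difference t i))
  zero    : ∀ (ℓ : Fin 3) → toℕ x ≡ toℕ ℓ * r → LiftStep r t x r

F₃ : ∀ r → (Fin (r ∸ 1) → Fin r) → Digraph (3 * r)
F₃ r t = withSteps (LiftStep r t)

module _ (r : ℕ) .{{_ : NonZero r}} where

  -- x is the element ã_j of ℤ₃ᵣ congruent to a modulo r and to j modulo 3;
  -- it exists and is unique when 3 ∤ r, by the Chinese remainder theorem.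
  IsPort : ℕ → Fin 3 → Fin (3 * r) → Set
  IsPort a j x = toℕ x mod r ≡ a mod r × toℕ x mod 3 ≡ j

  data FixedPortStep (t : Fin (r ∸ 1) → Fin r) (j : Fin 3) (x : Fin (3 * r)) : ℕ → Set where
    port₉     : IsPort 9 j x → FixedPortStep t j x 1
    port₆     : IsPort 6 j x → FixedPortStep t j x r
    port₃     : IsPort 3 j x → FixedPortStep t j x (r ∸ 3)
    port₀     : IsPort 0 j x → FixedPortStep t j x 7
    unchanged : ∀ {s} →
                ¬ IsPort 9 j x → ¬ IsPort 6 j x → ¬ IsPort 3 j x → ¬ IsPort 0 j x →
                LiftStep r t x s → FixedPortStep t j x s

  fixedPort : (Fin (r ∸ 1) → Fin r) → Fin 3 → Digraph (3 * r)
  fixedPort t j = withSteps (FixedPortStep t j)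

  evenPath : Fin (1 + r) → Fin (3 * r)
  evenPath i = _mod_ (2 * toℕ i) (3 * r) {{m*n≢0 3 r}}

{-# OPTIONS --safe #-}

-- Only the arcs of step 2 matter.  No port receives step 2, so the step-2 arcs
-- of H lie among those of F₃(T): their tails are all congruent modulo r to the
-- unique c such that T has difference 2 at c.  As H is balanced, they have one
-- tail in each residue class modulo 3, hence their tails are all the elements of
-- ℤ₃ᵣ congruent to c modulo r.  So the arc 2i → 2i + 2 lies in Hₖ if and only if
-- 2i ≡ c + 3k (mod r), and since r is odd this has exactly one solution i ∈ ℤᵣ
-- for every k.

module Submission where

open import Defs
open import Data.Fin using (Fin; toℕ; fromℕ<; inject₁) renaming (suc to fsuc)
open import Data.Fin.Properties
  using (nonZeroIndex; toℕ-fromℕ<; toℕ-injective; toℕ<n; toℕ≤pred[n]; toℕ-inject₁)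
open import Data.List using ([]; _∷_)
open import Data.Nat
open import Data.Nat.Coprimality using (Coprime; coprime-divisor)
open import Data.Nat.Divisibility
open import Data.Nat.DivMod
open import Data.Nat.Properties
open import Data.Nat.Tactic.RingSolver using (solve-∀)
open import Data.Product using (∃; _×_; _,_; proj₁; proj₂)
open import Data.Sum using (inj₁; inj₂)
open import Function using (Injective)
open import Relation.Binary.PropositionalEquality
open import Relation.Nullary using (contradiction)

-- Congruences between natural numbers.

module _ (n : ℕ) .{{_ : NonZero n}} where

  -- The equal remainders cancel, leaving a difference of multiples of `n`. The absolute difference
  -- keeps congruence within ℕ without ordering `a` and `b`, and turns cancellation laws into facts
  -- about divisibility.
  %≡⇒∣dist : ∀ a b → a % n ≡ b % n → n ∣ ∣ a - b ∣
  %≡⇒∣dist a b eq = divides ∣ a / n - b / n ∣ (begin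
    ∣ a - b ∣                                          ≡⟨ cong₂ ∣_-_∣ (m≡m%n+[m/n]*n a n) (m≡m%n+[m/n]*n b n) ⟩
    ∣ a % n + a / n * n - b % n + b / n * n ∣          ≡⟨ cong (λ e → ∣ a % n + a / n * n - e + b / n * n ∣) (sym eq) ⟩
    ∣ a % n + a / n * n - a % n + b / n * n ∣          ≡⟨ ∣m+n-m+o∣≡∣n-o∣ (a % n) _ _ ⟩
    ∣ a / n * n - b / n * n ∣                          ≡⟨ *-distribʳ-∣-∣ n (a / n) (b / n) ⟨
    ∣ a / n - b / n ∣ * n                              ∎)
    where open ≡-Reasoning

  ∣dist⇒%≡ : ∀ a b → n ∣ ∣ a - b ∣ → a % n ≡ b % n
  ∣dist⇒%≡ a b n∣d with ≤-total a b
  ... | inj₁ a≤b = sym (trans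
    (cong (_% n) (sym (m+[n∸m]≡n a≤b)))
    (%-remove-+ʳ a (subst (n ∣_) (m≤n⇒∣m-n∣≡n∸m a≤b) n∣d)))
  ... | inj₂ b≤a = trans
    (cong (_% n) (sym (m+[n∸m]≡n b≤a)))
    (%-remove-+ʳ b (subst (n ∣_) (m≤n⇒∣n-m∣≡n∸m b≤a) n∣d))

  %-+-cancelˡ : ∀ c a b → (c + a) % n ≡ (c + b) % n → a % n ≡ b % n
  %-+-cancelˡ c a b eq = ∣dist⇒%≡ a b
    (subst (n ∣_) (∣m+n-m+o∣≡∣n-o∣ c a b) (%≡⇒∣dist (c + a) (c + b) eq))

  %-*-cancelˡ : ∀ c → Coprime n c → ∀ a b → (c * a) % n ≡ (c * b) % n → a % n ≡ b % n
  %-*-cancelˡ c n⊥c a b eq = ∣dist⇒%≡ a b (coprime-divisor n⊥c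
    (subst (n ∣_) (sym (*-distribˡ-∣-∣ c a b)) (%≡⇒∣dist (c * a) (c * b) eq)))

  %-+-congʳ : ∀ a b c → a % n ≡ b % n → (a + c) % n ≡ (b + c) % n
  %-+-congʳ a b c eq = begin
    (a + c) % n            ≡⟨ %-distribˡ-+ a c n ⟩
    (a % n + c % n) % n    ≡⟨ cong (λ e → (e + c % n) % n) eq ⟩
    (b % n + c % n) % n    ≡⟨ %-distribˡ-+ b c n ⟨
    (b + c) % n            ∎
    where open ≡-Reasoning

  [m%n+o]%n≡[m+o]%n : ∀ m o → (m % n + o) % n ≡ (m + o) % n
  [m%n+o]%n≡[m+o]%n m o = %-+-congʳ (m % n) m o (m%n%n≡m%n m n)

%-weaken : ∀ m n .{{_ : NonZero m}} .{{_ : NonZero n}} → m ∣ n →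
           ∀ a b → a % n ≡ b % n → a % m ≡ b % m
%-weaken m n m∣n a b eq = ∣dist⇒%≡ m a b (∣-trans m∣n (%≡⇒∣dist n a b eq))

-- Uniqueness in the Chinese remainder theorem: the distance is `m * q`, and `n`, being coprime to
-- `m`, must divide `q`.
%-combine : ∀ m n .{{_ : NonZero m}} .{{_ : NonZero n}} .{{_ : NonZero (m * n)}} →
            Coprime n m → ∀ a b → a % m ≡ b % m → a % n ≡ b % n → a % (m * n) ≡ b % (m * n)
%-combine m n n⊥m a b eqₘ eqₙ with %≡⇒∣dist m a b eqₘ
... | divides q d≡q*m = ∣dist⇒%≡ (m * n) a b
  (subst (m * n ∣_) (sym d≡m*q) (*-monoʳ-∣ m (coprime-divisor n⊥m (subst (n ∣_) d≡m*q (%≡⇒∣dist n a b eqₙ)))))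
  where d≡m*q = trans d≡q*m (*-comm q m)

-- Translations of ℤₙ.

toℕ-mod : ∀ m n .{{_ : NonZero n}} → toℕ (m mod n) ≡ m % n
toℕ-mod m n = toℕ-fromℕ< (m%n<n m n)

mod≡⇒%≡ : ∀ a b n .{{_ : NonZero n}} → a mod n ≡ b mod n → a % n ≡ b % n
mod≡⇒%≡ a b n eq = trans (sym (toℕ-mod a n)) (trans (cong toℕ eq) (toℕ-mod b n))

module _ {n : ℕ} .{{n≢0 : NonZero n}} where

  toℕ-⊕ : ∀ (x : Fin n) m → toℕ (x ⊕ m) ≡ (toℕ x + m) % n
  toℕ-⊕ x m = toℕ-mod (toℕ x + m) n {{nonZeroIndex x}}

  ⊕≡⇒%≡ : ∀ (x y : Fin n) a b → x ⊕ a ≡ y ⊕ b → (toℕ x + a) % n ≡ (toℕ y + b) % n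
  ⊕≡⇒%≡ x y a b eq = trans (sym (toℕ-⊕ x a)) (trans (cong toℕ eq) (toℕ-⊕ y b))

  ⊕-assoc : ∀ (x : Fin n) a b → x ⊕ a ⊕ b ≡ x ⊕ (a + b)
  ⊕-assoc x a b = toℕ-injective (begin
    toℕ (x ⊕ a ⊕ b)               ≡⟨ toℕ-⊕ (x ⊕ a) b ⟩
    (toℕ (x ⊕ a) + b) % n         ≡⟨ cong (λ e → (e + b) % n) (toℕ-⊕ x a) ⟩
    ((toℕ x + a) % n + b) % n     ≡⟨ [m%n+o]%n≡[m+o]%n n (toℕ x + a) b ⟩
    (toℕ x + a + b) % n           ≡⟨ cong (_% n) (+-assoc (toℕ x) a b) ⟩
    (toℕ x + (a + b)) % n         ≡⟨ toℕ-⊕ x (a + b) ⟨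
    toℕ (x ⊕ (a + b))             ∎)
    where open ≡-Reasoning

  ⊕-comm : ∀ (x : Fin n) a b → x ⊕ a ⊕ b ≡ x ⊕ b ⊕ a
  ⊕-comm x a b = trans (⊕-assoc x a b) (trans (cong (x ⊕_) (+-comm a b)) (sym (⊕-assoc x b a)))

  -- Steps are natural numbers, so two endpoints determine a step only among values below `n`.
  ⊕-cancelˡ : ∀ (x : Fin n) {a b} → a < n → b < n → x ⊕ a ≡ x ⊕ b → a ≡ b
  ⊕-cancelˡ x {a} {b} a<n b<n eq = begin
    a      ≡⟨ m<n⇒m%n≡m a<n ⟨
    a % n  ≡⟨ %-+-cancelˡ n (toℕ x) a b (⊕≡⇒%≡ x x a b eq) ⟩
    b % n  ≡⟨ m<n⇒m%n≡m b<n ⟩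
    b      ∎
    where open ≡-Reasoning

  ⊕-cancelʳ : ∀ (x y : Fin n) m → x ⊕ m ≡ y ⊕ m → x ≡ y
  ⊕-cancelʳ x y m eq = toℕ-injective (begin
    toℕ x      ≡⟨ m<n⇒m%n≡m (toℕ<n x) ⟨
    toℕ x % n  ≡⟨ %-+-cancelˡ n m (toℕ x) (toℕ y) m+x≡m+y ⟩
    toℕ y % n  ≡⟨ m<n⇒m%n≡m (toℕ<n y) ⟩
    toℕ y      ∎)
    where
    open ≡-Reasoning
    m+x≡m+y : (m + toℕ x) % n ≡ (m + toℕ y) % n
    m+x≡m+y = begin
      (m + toℕ x) % n  ≡⟨ cong (_% n) (+-comm m (toℕ x)) ⟩
      (toℕ x + m) % n  ≡⟨ ⊕≡⇒%≡ x y m m eq ⟩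
      (toℕ y + m) % n  ≡⟨ cong (_% n) (+-comm (toℕ y) m) ⟩
      (m + toℕ y) % n  ∎

  -- Translation preserves steps: it commutes with `_⊕ s` and is injective, so the head of the
  -- original arc is forced.
  translate-step⁻ : ∀ (H : Digraph n) m x s → translate H m x (x ⊕ s) →
                    ∃ λ x′ → x′ ⊕ m ≡ x × H x′ (x′ ⊕ s)
  translate-step⁻ H m _ s (x′ , y′ , h , refl , eq) =
    x′ , refl , subst (H x′) (⊕-cancelʳ y′ (x′ ⊕ s) m (trans eq (⊕-comm x′ m s))) h

  translate-step⁺ : ∀ (H : Digraph n) m x s → H x (x ⊕ s) → translate H m (x ⊕ m) (x ⊕ m ⊕ s)
  translate-step⁺ H m x s h = x , x ⊕ s , h , refl , ⊕-comm x s m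

-- The path of even numbers in ℤ₃ᵣ.

module _ (r : ℕ) .{{_ : NonZero r}} where

  private instance
    3r≢0 : NonZero (3 * r)
    3r≢0 = m*n≢0 3 r

  toℕ-evenPath : ∀ i → toℕ (evenPath r i) ≡ (2 * toℕ i) % (3 * r)
  toℕ-evenPath i = toℕ-mod (2 * toℕ i) (3 * r)

  -- No wraparound occurs, since 2i ≤ 2r < 3r.
  evenPath-injective : Injective _≡_ _≡_ (evenPath r)
  evenPath-injective {i} {k} eq = toℕ-injective (*-cancelˡ-≡ (toℕ i) (toℕ k) 2 (begin
    2 * toℕ i            ≡⟨ m<n⇒m%n≡m (2i<3r i) ⟨
    2 * toℕ i % (3 * r)  ≡⟨ mod≡⇒%≡ (2 * toℕ i) (2 * toℕ k) (3 * r) eq ⟩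
    2 * toℕ k % (3 * r)  ≡⟨ m<n⇒m%n≡m (2i<3r k) ⟩
    2 * toℕ k            ∎))
    where
    open ≡-Reasoning
    2i<3r : ∀ (i : Fin (1 + r)) → 2 * toℕ i < 3 * r
    2i<3r i = ≤-<-trans (*-monoʳ-≤ 2 (toℕ≤pred[n] i)) (*-monoˡ-< r (n<1+n 2))

  evenPath-suc : ∀ (i : Fin r) → evenPath r (fsuc i) ≡ evenPath r (inject₁ i) ⊕ 2
  evenPath-suc i = toℕ-injective (begin
    toℕ (evenPath r (fsuc i))                  ≡⟨ toℕ-evenPath (fsuc i) ⟩
    (2 * suc (toℕ i)) % (3 * r)                ≡⟨ cong (_% (3 * r)) (trans (*-suc 2 (toℕ i)) (+-comm 2 _)) ⟩
    (2 * toℕ i + 2) % (3 * r)                  ≡⟨ cong (λ e → (2 * e + 2) % (3 * r)) (toℕ-inject₁ i) ⟨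
    (2 * toℕ (inject₁ i) + 2) % (3 * r)        ≡⟨ [m%n+o]%n≡[m+o]%n (3 * r) (2 * toℕ (inject₁ i)) 2 ⟨
    ((2 * toℕ (inject₁ i)) % (3 * r) + 2) % (3 * r) ≡⟨ cong (λ e → (e + 2) % (3 * r)) (toℕ-evenPath (inject₁ i)) ⟨
    (toℕ (evenPath r (inject₁ i)) + 2) % (3 * r) ≡⟨ toℕ-⊕ (evenPath r (inject₁ i)) 2 ⟨
    toℕ (evenPath r (inject₁ i) ⊕ 2)           ∎)
    where open ≡-Reasoning

  -- For odd r the inverse of 2 is `h` = (r + 1) / 2, because 2h = r + 1.
  halve : r % 2 ≡ 1 → ∀ e → ∃ λ (i : Fin r) → (2 * toℕ i) % r ≡ e % r
  halve odd e = (e * h) mod r , (begin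
    (2 * toℕ ((e * h) mod r)) % r            ≡⟨ cong (λ a → (2 * a) % r) (toℕ-mod (e * h) r) ⟩
    (2 * (e * h % r)) % r                    ≡⟨ %-distribˡ-* 2 (e * h % r) r ⟩
    ((2 % r) * (e * h % r % r)) % r          ≡⟨ cong (λ a → ((2 % r) * a) % r) (m%n%n≡m%n (e * h) r) ⟩
    ((2 % r) * (e * h % r)) % r              ≡⟨ %-distribˡ-* 2 (e * h) r ⟨
    (2 * (e * h)) % r                        ≡⟨ cong (_% r) (expand e (r / 2)) ⟩
    (e + e * (1 + r / 2 * 2)) % r            ≡⟨ cong (λ a → (e + e * a) % r) r≡1+[r/2]*2 ⟨
    (e + e * r) % r                          ≡⟨ [m+kn]%n≡m%n e e r ⟩
    e % r                                    ∎)
    where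
    open ≡-Reasoning
    h = 1 + r / 2
    r≡1+[r/2]*2 : r ≡ 1 + r / 2 * 2
    r≡1+[r/2]*2 = trans (m≡m%n+[m/n]*n r 2) (cong (_+ r / 2 * 2) odd)
    expand : ∀ e q → 2 * (e * (1 + q)) ≡ e + e * (1 + q * 2)
    expand = solve-∀

  -- The hypotheses on H say that its step-2 arcs are exactly those whose tails
  -- are congruent to c modulo r.
  module _ (r⊥2 : Coprime r 2) (r⊥3 : Coprime r 3) (r%2≡1 : r % 2 ≡ 1) (2≤r : 2 ≤ r)
           (H : Digraph (3 * r)) (c : ℕ)
           (tail≡c : ∀ x → H x (x ⊕ 2) → toℕ x % r ≡ c % r)
           (tail-in : ∀ (j : Fin 3) → ∃ λ x → toℕ x mod 3 ≡ j × H x (x ⊕ 2)) where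

    private
      at : Fin r → Fin (3 * r)
      at i = evenPath r (inject₁ i)

      toℕ-at : ∀ i → toℕ (at i) ≡ (2 * toℕ i) % (3 * r)
      toℕ-at i = trans (toℕ-evenPath (inject₁ i)) (cong (λ e → (2 * e) % (3 * r)) (toℕ-inject₁ i))

    layer⇒2i≡c+3k : ∀ k i → layer r H k (at i) (at i ⊕ 2) → (2 * toℕ i) % r ≡ (c + 3 * toℕ k) % r
    layer⇒2i≡c+3k k i arc with translate-step⁻ H (3 * toℕ k) (at i) 2 arc
    ... | x , x+3k≡2i , h = begin
      (2 * toℕ i) % r          ≡⟨ %-weaken r (3 * r) (n∣m*n 3) (toℕ x + 3 * toℕ k) (2 * toℕ i) (begin
          (toℕ x + 3 * toℕ k) % (3 * r)  ≡⟨ toℕ-⊕ x (3 * toℕ k) ⟨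
          toℕ (x ⊕ 3 * toℕ k)            ≡⟨ cong toℕ x+3k≡2i ⟩
          toℕ (at i)                     ≡⟨ toℕ-at i ⟩
          (2 * toℕ i) % (3 * r)          ∎) ⟨
      (toℕ x + 3 * toℕ k) % r  ≡⟨ %-+-congʳ r (toℕ x) c (3 * toℕ k) (tail≡c x h) ⟩
      (c + 3 * toℕ k) % r      ∎
      where open ≡-Reasoning

    -- Take the step-2 tail x lying in the class of 2i modulo 3. Shifting by 3k keeps that class and
    -- moves x to c + 3k modulo r, so by the Chinese remainder theorem it lands exactly on 2i.
    2i≡c+3k⇒layer : ∀ k i → (2 * toℕ i) % r ≡ (c + 3 * toℕ k) % r → layer r H k (at i) (at i ⊕ 2)
    2i≡c+3k⇒layer k i eq with tail-in ((2 * toℕ i) mod 3)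
    ... | x , x≡2i , h =
      subst (λ y → layer r H k y (y ⊕ 2)) x+3k≡2i (translate-step⁺ H (3 * toℕ k) x 2 h)
      where
      open ≡-Reasoning
      mod-3 : (toℕ x + 3 * toℕ k) % 3 ≡ (2 * toℕ i) % 3
      mod-3 = trans (%-remove-+ʳ (toℕ x) (m∣m*n (toℕ k))) (mod≡⇒%≡ (toℕ x) (2 * toℕ i) 3 x≡2i)
      mod-r : (toℕ x + 3 * toℕ k) % r ≡ (2 * toℕ i) % r
      mod-r = trans (%-+-congʳ r (toℕ x) c (3 * toℕ k) (tail≡c x h)) (sym eq)
      x+3k≡2i : x ⊕ 3 * toℕ k ≡ at i
      x+3k≡2i = toℕ-injective (begin
        toℕ (x ⊕ 3 * toℕ k)            ≡⟨ toℕ-⊕ x (3 * toℕ k) ⟩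
        (toℕ x + 3 * toℕ k) % (3 * r)  ≡⟨ %-combine 3 r r⊥3 (toℕ x + 3 * toℕ k) (2 * toℕ i) mod-3 mod-r ⟩
        (2 * toℕ i) % (3 * r)          ≡⟨ toℕ-at i ⟨
        toℕ (at i)                     ∎)

    evenPath-isDeletionChain : IsDeletionChain r H (evenPath r)
    evenPath-isDeletionChain =
      evenPath-injective ,
      (λ i → 2 , (s≤s z≤n , 2≤r) , evenPath-suc i) ,
      -- Halving c + 3k gives the arc in layer k; cancelling 2 modulo r gives its uniqueness.
      λ k → let i , 2i≡c+3k = halve r%2≡1 (c + 3 * toℕ k) in
        i ,
        subst (layer r H k (at i)) (sym (evenPath-suc i)) (2i≡c+3k⇒layer k i 2i≡c+3k) ,
        λ {i′} arc → toℕ-injective (begin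
          toℕ i       ≡⟨ m<n⇒m%n≡m (toℕ<n i) ⟨
          toℕ i % r   ≡⟨ %-*-cancelˡ r 2 r⊥2 (toℕ i) (toℕ i′) (trans 2i≡c+3k
                           (sym (layer⇒2i≡c+3k k i′ (subst (layer r H k (at i′)) (evenPath-suc i′) arc)))) ⟩
          toℕ i′ % r  ≡⟨ m<n⇒m%n≡m (toℕ<n i′) ⟩
          toℕ i′      ∎)
      where open ≡-Reasoning

  -- Arcs of step 2 in the output of the fixed-port construction.

  module _ (11≤r : 11 ≤ r) (t : Fin (r ∸ 1) → Fin r) (j : Fin 3) where

    fixedPortStep≤r : ∀ {x s} → FixedPortStep r t j x s → s ≤ r
    fixedPortStep≤r (port₉ _) = ≤-trans (s≤s z≤n) 11≤r
    fixedPortStep≤r (port₆ _) = ≤-refl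
    fixedPortStep≤r (port₃ _) = m∸n≤m r 3
    fixedPortStep≤r (port₀ _) = ≤-trans (m≤m+n 7 4) 11≤r
    fixedPortStep≤r (unchanged _ _ _ _ (nonzero _ i _)) = <⇒≤ (toℕ<n (difference t i))
    fixedPortStep≤r (unchanged _ _ _ _ (zero _ _)) = ≤-refl

    -- The step is tied to 2 by an equation because the indices `r ∸ 3` and `toℕ (difference t i)`
    -- do not unify with 2. Steps 1 and 7 are absurd at once; steps r and r - 3 are at least 8.
    stepTwo⇒difference : ∀ {x s} → FixedPortStep r t j x s → s ≡ 2 →
                         ∃ λ i → toℕ (difference t i) ≡ 2 × toℕ x % r ≡ toℕ (t i) % r
    stepTwo⇒difference (port₆ _) r≡2 = contradiction (subst (11 ≤_) r≡2 11≤r) λ { (s≤s (s≤s ())) }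
    stepTwo⇒difference (port₃ _) r∸3≡2 =
      contradiction (subst (8 ≤_) r∸3≡2 (∸-monoˡ-≤ 3 11≤r)) λ { (s≤s (s≤s ())) }
    stepTwo⇒difference (unchanged _ _ _ _ (zero _ _)) r≡2 =
      contradiction (subst (11 ≤_) r≡2 11≤r) λ { (s≤s (s≤s ())) }
    stepTwo⇒difference (unchanged _ _ _ _ (nonzero ℓ i x≡)) d≡2 =
      i , d≡2 , trans (cong (_% r) x≡) ([m+kn]%n≡m%n (toℕ (t i)) (toℕ ℓ) r)

    fixedPort-stepTwo : ∀ x → fixedPort r t j x (x ⊕ 2) →
                        ∃ λ i → toℕ (difference t i) ≡ 2 × toℕ x % r ≡ toℕ (t i) % r
    fixedPort-stepTwo x (s , step , eq) = stepTwo⇒difference step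
      -- Both steps are below 3r, so the common head forces `s` to be 2.
      (⊕-cancelˡ x (≤-<-trans (fixedPortStep≤r step) r<3r) (≤-<-trans (≤-trans (m≤m+n 2 9) 11≤r) r<3r) (sym eq))
      where
      r<3r : r < 3 * r
      r<3r = subst (_< 3 * r) (*-identityˡ r) (*-monoˡ-< r (m≤m+n 2 1))

-- A common divisor of r and 6 divides the remainder 5, hence also 6 - 5 = 1.
%6≡5⇒coprime-6 : ∀ r → r % 6 ≡ 5 → Coprime r 6
%6≡5⇒coprime-6 r eq {d} (d∣r , d∣6) =
  ∣1⇒≡1 (∣m+n∣m⇒∣n {m = 5} {n = 1} d∣6 (subst (d ∣_) eq (%-presˡ-∣ d∣r d∣6)))

proposition7p2 : ∀ (r : ℕ) .{{_ : NonZero r}} → r % 6 ≡ 5 → 11 ≤ r →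
    ∀ (t : Fin (r ∸ 1) → Fin r) → IsTerrace t →
    ContainsPath t (9 ∷ 6 ∷ 7 ∷ 5 ∷ 8 ∷ 3 ∷ 10 ∷ []) →
    ∀ (j : Fin 3) → IsBalancedStarter r (fixedPort r t j) →
    IsChainCompatible r (fixedPort r t j) × IsDeletionChain r (fixedPort r t j) (evenPath r)
proposition7p2 r r%6≡5 11≤r t (_ , differences) _ j (_ , balanced) = (evenPath r , chain) , chain
  where
  r⊥6 : Coprime r 6
  r⊥6 = %6≡5⇒coprime-6 r r%6≡5

  2≤r : 2 ≤ r
  2≤r = ≤-trans (m≤m+n 2 9) 11≤r

  2<r : 2 < r
  2<r = ≤-trans (m≤m+n 3 8) 11≤r

  -- The terrace property, applied to the residue 2, gives a single index; this is what confines all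
  -- step-2 tails to one class modulo r.
  difference-two : ∃ λ i → difference t i ≡ fromℕ< 2<r × (∀ {i′} → difference t i′ ≡ fromℕ< 2<r → i ≡ i′)
  difference-two = proj₂ differences (fromℕ< 2<r) λ eq → contradiction (trans (sym (toℕ-fromℕ< 2<r)) eq) λ ()

  c : ℕ
  c = toℕ (t (proj₁ difference-two))

  tail≡c : ∀ x → fixedPort r t j x (x ⊕ 2) → toℕ x % r ≡ c % r
  tail≡c x arc with fixedPort-stepTwo r 11≤r t j x arc
  ... | i , d≡2 , x≡tᵢ = trans x≡tᵢ (cong (λ i → toℕ (t i) % r) (sym
    (proj₂ (proj₂ difference-two) (toℕ-injective (trans d≡2 (sym (toℕ-fromℕ< 2<r)))))))

  tail-in : ∀ (j′ : Fin 3) → ∃ λ x → toℕ x mod 3 ≡ j′ × fixedPort r t j x (x ⊕ 2)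
  tail-in j′ with balanced j′ 2 (s≤s z≤n , 2≤r)
  ... | x , arc , _ = x , arc

  chain : IsDeletionChain r (fixedPort r t j) (evenPath r)
  chain = evenPath-isDeletionChain r
    (λ (d∣r , d∣2) → r⊥6 (d∣r , ∣-trans d∣2 (divides 3 refl)))
    (λ (d∣r , d∣3) → r⊥6 (d∣r , ∣-trans d∣3 (divides 2 refl)))
    -- Parity is read off the remainder modulo 6: 5 is odd.
    (trans (sym (m∣n⇒o%n%m≡o%m 2 6 r (divides 3 refl))) (cong (_% 2) r%6≡5))
    2≤r (fixedPort r t j) c tail≡c tail-in
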